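{- Consider computations based on the point-hyperplane incidence graph of the 5-dimensional projective space $\mathbb{P}(5,\mathbb{GF}(2))$. It is possible to fold the computations and arrange a scheduling that can be executed using 21 processing units and 21 dual port memories; that is, there exists a folded conflict-free schedule for this graph (in the sense defined in the context) with $N=21$.
   Context: $\mathbb{P}(5,\mathbb{GF}(2))$ is the projective space of a 6-dimensional vector space $\mathbb{V}$ over $\mathbb{GF}(2)$. Points are the 63 one-dimensional vector subspaces of $\mathbb{V}$; hyperplanes are the 63 five-dimensional vector subspaces of $\mathbb{V}$. The point-hyperplane incidence graph is the bipartite graph with one vertex per point and one vertex per hyperplane, and an edge between a point and a hyperplane iff the point is contained in the hyperplane; every vertex has degree 31. Let $E$ be its edge set. Each edge represents one data word. Each vertex represents an atomic computation that reads, and afterwards updates, the data words of all edges incident with that vertex. The overall computation has two phases: in Phase 1 all point vertices compute, in Phase 2 all hyperplane vertices compute. A folded conflict-free schedule with $N$ processing units and $N$ dual port memories consists of the following. (1) A partition of the point set into $N$ blocks $A_1,\dots,A_N$ of equal size and a partition of the hyperplane set into $N$ blocks $B_1,\dots,B_N$ of equal size. Processing unit $i$ performs, one vertex at a time, the computations of the points of $A_i$ in Phase 1 and of the hyperplanes of $B_i$ in Phase 2. (2) A map $\mu:E\to\{1,\dots,N\}$ assigning to each data word the memory in which it is stored; the word is read from and written back to the same location of this memory throughout both phases (no data is moved between memories). (3) For each phase and each unit $i$, an ordering $e_{i,1},\dots,e_{i,R}$ (with $R=31\cdot 63/N$) of all edges incident with the vertices of the block of unit $i$ in that phase, in which the 31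 edges incident with any given vertex are consecutive, and such that for every time step $r\in\{1,\dots,R\}$ the memories $\mu(e_{1,r}),\dots,\mu(e_{N,r})$ are pairwise distinct. Thus at each step every unit accesses exactly one word (no unit is idle) and no two units access the same memory. Inputs are read in this order through one port of the memories, and the outputs are written back in the same order through the second port. -}

module Defs where

open import Data.Bool.Base using (Bool; false; _xor_; _∧_)
open import Data.Fin.Base using (Fin; _≤_)
open import Data.Nat.Base as ℕ using (ℕ; NonZero)
open import Data.Nat.DivMod using (_/_)
open import Data.Product.Base using (Σ-syntax; ∃; _,_; proj₁; proj₂)
open import Data.Product.Relation.Binary.Pointwise.NonDependent using (×-setoid)
open import Data.Vec.Base using (Vec; []; _∷_; map; replicate; zipWith)
open import Data.Vec.Relation.Unary.All using (All)
open import Function.Base using (_∘_)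
open import Function.Bundles using (Func; Bijection)
open import Function.Definitions using (Injective)
open import Level using (Level; 0ℓ; _⊔_)
open import Relation.Binary.Bundles using (Setoid)
import Relation.Binary.Construct.On as On
open import Relation.Binary.PropositionalEquality using (_≡_)
open import Relation.Binary.PropositionalEquality.Properties using (setoid)
open import Relation.Unary using (Pred; _∈_; _⊆_)
open import Relation.Unary.Relation.Binary.Equality using (≐-setoid)

open Func using (to)
open Setoid using (Carrier)

private variable
  a ℓ b : Level
  n d : ℕ

-- The field with two elements is Bool, with _xor_ as addition and _∧_ as
-- multiplication (Data.Bool.Properties.xor-∧-commutativeRing).

GF2 : Set
GF2 = Bool

𝕍 : ℕ → Set
𝕍 n = Vec GF2 n

0ᵛ : 𝕍 n
0ᵛ = replicate _ false

infixl 6 _+ᵛ_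
infixr 7 _*ᵛ_

_+ᵛ_ : 𝕍 n → 𝕍 n → 𝕍 n
_+ᵛ_ = zipWith _xor_

_*ᵛ_ : GF2 → 𝕍 n → 𝕍 n
c *ᵛ v = map (c ∧_) v

combination : Vec GF2 d → Vec (𝕍 n) d → 𝕍 n
combination []       []       = 0ᵛ
combination (c ∷ cs) (v ∷ vs) = c *ᵛ v +ᵛ combination cs vs

record IsSubspace (U : Pred (𝕍 n) 0ℓ) : Set where
  field
    0-closed : 0ᵛ ∈ U
    +-closed : ∀ {u v} → u ∈ U → v ∈ U → u +ᵛ v ∈ U
    *-closed : ∀ c {v} → v ∈ U → c *ᵛ v ∈ U

record IsBasis (U : Pred (𝕍 n) 0ℓ) (vs : Vec (𝕍 n) d) : Set where
  field
    contained   : All U vs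
    independent : ∀ cs → combination cs vs ≡ 0ᵛ → cs ≡ replicate d false
    spanning    : ∀ {u} → u ∈ U → ∃ λ cs → combination cs vs ≡ u

record Subspace (n d : ℕ) : Set₁ where
  field
    ⟦_⟧        : Pred (𝕍 n) 0ℓ
    isSubspace : IsSubspace ⟦_⟧
    dimension  : Σ[ vs ∈ Vec (𝕍 n) d ] IsBasis ⟦_⟧ vs

open Subspace public using (⟦_⟧)

-- Subspaces are compared as sets of vectors: the chosen basis is irrelevant.

SubspaceSetoid : ℕ → ℕ → Setoid _ _
SubspaceSetoid n d = On.setoid {B = Subspace n d} (≐-setoid (𝕍 n) 0ℓ) ⟦_⟧

-- The projective space ℙ(5, GF(2)) of 𝕍 6.

Point Hyperplane : Set₁
Point      = Subspace 6 1
Hyperplane = Subspace 6 5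

record Edge : Set₁ where
  field
    point      : Point
    hyperplane : Hyperplane
    incident   : ⟦ point ⟧ ⊆ ⟦ hyperplane ⟧

Points Hyperplanes Edges : Setoid _ _
Points      = SubspaceSetoid 6 1
Hyperplanes = SubspaceSetoid 6 5
Edges       = On.setoid (×-setoid Points Hyperplanes)
                        (λ e → Edge.point e , Edge.hyperplane e)

pointOf : Func Edges Points
pointOf = record { to = Edge.point ; cong = proj₁ }

hyperplaneOf : Func Edges Hyperplanes
hyperplaneOf = record { to = Edge.hyperplane ; cong = proj₂ }

Fibre : (S : Setoid a ℓ) {A : Set b} → (Carrier S → A) → A → Setoid (a ⊔ b) ℓ
Fibre S f x = On.setoid {B = Σ[ s ∈ Carrier S ] f s ≡ x} S proj₁

record EqualPartition (S : Setoid a ℓ) (N : ℕ) : Set (a ⊔ ℓ) where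
  field
    block     : Func S (setoid (Fin N))
    blockSize : ℕ
    equalSize : ∀ i → Bijection (setoid (Fin blockSize)) (Fibre S (to block) i)

-- The order in which the units access the words during one phase, where
-- `vertex` sends each edge to its end that computes in this phase.

record ConflictFreeOrder {N : ℕ} (R : ℕ)
                         (V : Setoid a ℓ) (vertex : Func Edges V)
                         (units : EqualPartition V N)
                         (μ : Func Edges (setoid (Fin N)))
                         : Set (Level.suc 0ℓ ⊔ a ⊔ ℓ) where
  open Setoid V using (_≈_)
  open EqualPartition units using (block)

  field
    order : ∀ i → Bijection (setoid (Fin R)) (Fibre Edges (to block ∘ to vertex) i)

  access : Fin N → Fin R → Edge
  access i r = proj₁ (Bijection.to (order i) r)

  field
    consecutive  : ∀ i {r s t} → r ≤ s → s ≤ t →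
                   to vertex (access i r) ≈ to vertex (access i t) →
                   to vertex (access i s) ≈ to vertex (access i r)
    conflictFree : ∀ r → Injective _≡_ _≡_ (λ i → to μ (access i r))

-- Each access order governs both the reads, through one port, and the
-- write-backs, through the other, so it is subject to a single condition.

record FoldedConflictFreeSchedule (N : ℕ) .{{_ : NonZero N}} : Set₁ where
  R : ℕ
  R = (31 ℕ.* 63) / N

  field
    pointUnits      : EqualPartition Points N
    hyperplaneUnits : EqualPartition Hyperplanes N
    μ               : Func Edges (setoid (Fin N))
    phase₁          : ConflictFreeOrder R Points pointOf pointUnits μ
    phase₂          : ConflictFreeOrder R Hyperplanes hyperplaneOf hyperplaneUnits μ

{-# OPTIONS --safe #-}

-- A point of ℙ(5, GF(2)) is a nonzero vector v, a hyperplane is the orthogonal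
-- space of a nonzero vector w, and they are incident iff w ∙ v = 0.  Let M be a
-- symmetric matrix that generates a Singer cycle, so that the nonzero vectors
-- are the Mⁿ e₁ for n modulo 63, and let unit i own the points, and likewise the
-- hyperplanes, with n ≡ i modulo 21.  Store each word in the memory numbered as
-- the unit of its point.  Phase 1 is then conflict-free in any order.  In phase 2,
-- Mⁿ e₁ ∙ v = e₁ ∙ Mⁿ v, so the points on the hyperplane Mⁿ e₁ are the M⁻ⁿ d with d
-- nonzero and orthogonal to e₁; if at each step all units use the same d, then,
-- their n being distinct modulo 21, so are the exponents of the points accessed.

module Submission where

open import Algebra.Bundles using (CommutativeRing)
import Algebra.Properties.CommutativeSemigroup as CommutativeSemigroupProperties
open import Data.Bool.Base using (true; false; if_then_else_; _xor_; _∧_)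
open import Data.Bool.Properties as Bool
  using (xor-same; xor-identityʳ; ∧-distribʳ-xor; ∧-distribˡ-xor; ∧-comm; ∧-zeroʳ; ∧-identityʳ;
         xor-∧-commutativeRing; ⇔→≡)
open import Data.Fin.Base as Fin using (Fin; zero; suc; toℕ; combine; remQuot)
open import Data.Fin.Properties as Fin
  using (2↔Bool; *↔×; pigeonhole; combine-remQuot; remQuot-combine; combine-monoˡ-<)
open import Data.Nat.Base as ℕ using (ℕ; zero; suc; z<s; s<s)
open import Data.Nat.DivMod using (_mod_)
open import Data.Nat.GeneralisedArithmetic using (fold; iterate)
open import Data.Nat.Properties using (^-monoʳ-<; n<1+n; ≮⇒≥; <⇒≱)
open import Data.Product.Base using (∃; _×_; _,_; proj₁; proj₂; uncurry)
open import Data.Product.Function.NonDependent.Propositional using (_×-↔_)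
open import Data.Vec.Base using (Vec; []; _∷_; head; tail; map)
open import Data.Vec.Properties as Vec using (∷-injectiveˡ; ∷-injectiveʳ; map-id)
open import Data.Vec.Relation.Unary.All as All using (All; []; _∷_)
import Data.Vec.Relation.Unary.All.Properties as All
open import Function.Base using (_∘_; id; _$_)
open import Function.Bundles using (Func; Injection; Inverse; _↔_; mk↔ₛ′; mk⇔)
open import Function.Construct.Composition using (inverse)
open import Function.Construct.Symmetry using () renaming (inverse to sym-inverse)
open import Function.Definitions using (Injective)
open import Function.Properties.Inverse using (↔⇒↣)
open import Function.Related.TypeIsomorphisms using (×-comm)
open import Level using (Level; 0ℓ)
open import Relation.Binary.Bundles using (Setoid)
import Relation.Binary.Construct.On as On
open import Relation.Binary.Definitions using (DecidableEquality)
open import Relation.Binary.PropositionalEquality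
open import Relation.Nullary using (Dec; does; ¬?; contradiction)
open import Relation.Nullary.Decidable using (map′; _×-dec_; _→-dec_; from-yes)
open import Relation.Unary using (Pred; Decidable; _∈_; _⊆_)

open import Defs

open Func using (to)

private variable
  a ℓ : Level
  m n d : ℕ

-- Linear algebra over GF(2)

_≟_ : DecidableEquality (𝕍 n)
_≟_ = Vec.≡-dec Bool._≟_

-- Exhaustion over all 2ⁿ vectors; together with `from-yes` it settles the concrete claims about the
-- Singer cycle by evaluation.
all𝕍? : {P : Pred (𝕍 n) ℓ} → Decidable P → Dec (∀ v → P v)
all𝕍? {n = zero}  P? = map′ (λ p → λ { [] → p }) (_$ []) (P? [])
all𝕍? {n = suc n} P? =
  map′ (λ (p , q) → λ { (false ∷ v) → p v ; (true ∷ v) → q v })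
       (λ p → p ∘ (false ∷_) , p ∘ (true ∷_))
       (all𝕍? (P? ∘ (false ∷_)) ×-dec all𝕍? (P? ∘ (true ∷_)))

xor-interchange : ∀ a b c d → (a xor b) xor (c xor d) ≡ (a xor c) xor (b xor d)
xor-interchange = CommutativeSemigroupProperties.interchange
  (CommutativeRing.+-commutativeSemigroup xor-∧-commutativeRing)

xor≡false⇒≡ : ∀ a b → a xor b ≡ false → a ≡ b
xor≡false⇒≡ false b     eq = sym eq
xor≡false⇒≡ true  true  eq = refl

+ᵛ-identityˡ : (v : 𝕍 n) → 0ᵛ +ᵛ v ≡ v
+ᵛ-identityˡ = Vec.zipWith-identityˡ (λ _ → refl)

+ᵛ-identityʳ : (v : 𝕍 n) → v +ᵛ 0ᵛ ≡ v
+ᵛ-identityʳ = Vec.zipWith-identityʳ xor-identityʳ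

+ᵛ-self : (v : 𝕍 n) → v +ᵛ v ≡ 0ᵛ
+ᵛ-self []      = refl
+ᵛ-self (a ∷ v) = cong₂ _∷_ (xor-same a) (+ᵛ-self v)

+ᵛ≡0⇒≡ : (u v : 𝕍 n) → u +ᵛ v ≡ 0ᵛ → u ≡ v
+ᵛ≡0⇒≡ []      []      eq = refl
+ᵛ≡0⇒≡ (a ∷ u) (b ∷ v) eq =
  cong₂ _∷_ (xor≡false⇒≡ a b (∷-injectiveˡ eq)) (+ᵛ≡0⇒≡ u v (∷-injectiveʳ eq))

+ᵛ-interchange : (t u v w : 𝕍 n) → (t +ᵛ u) +ᵛ (v +ᵛ w) ≡ (t +ᵛ v) +ᵛ (u +ᵛ w)
+ᵛ-interchange []      []      []      []      = refl
+ᵛ-interchange (a ∷ t) (b ∷ u) (c ∷ v) (d ∷ w) =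
  cong₂ _∷_ (xor-interchange a b c d) (+ᵛ-interchange t u v w)

true-*ᵛ : (v : 𝕍 n) → true *ᵛ v ≡ v
true-*ᵛ = map-id

false-*ᵛ : (v : 𝕍 n) → false *ᵛ v ≡ 0ᵛ
false-*ᵛ v = Vec.map-const v false

*ᵛ-distribʳ : ∀ b c (v : 𝕍 n) → (b xor c) *ᵛ v ≡ b *ᵛ v +ᵛ c *ᵛ v
*ᵛ-distribʳ b c []      = refl
*ᵛ-distribʳ b c (a ∷ v) = cong₂ _∷_ (∧-distribʳ-xor a b c) (*ᵛ-distribʳ b c v)

-- Over GF(2) additive maps are linear.

Additive : (𝕍 m → 𝕍 n) → Set
Additive f = ∀ u v → f (u +ᵛ v) ≡ f u +ᵛ f v

*ᵛ-distribˡ : ∀ c → Additive {n} (c *ᵛ_)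
*ᵛ-distribˡ c []      []      = refl
*ᵛ-distribˡ c (a ∷ u) (b ∷ v) = cong₂ _∷_ (∧-distribˡ-xor c a b) (*ᵛ-distribˡ c u v)

additive-0 : {f : 𝕍 m → 𝕍 n} → Additive f → f 0ᵛ ≡ 0ᵛ
additive-0 {f = f} f-+ = begin
  f 0ᵛ          ≡⟨ cong f (+ᵛ-self 0ᵛ) ⟨
  f (0ᵛ +ᵛ 0ᵛ)  ≡⟨ f-+ 0ᵛ 0ᵛ ⟩
  f 0ᵛ +ᵛ f 0ᵛ  ≡⟨ +ᵛ-self (f 0ᵛ) ⟩
  0ᵛ            ∎
  where open ≡-Reasoning

additive-*ᵛ : {f : 𝕍 m → 𝕍 n} → Additive f → ∀ c v → f (c *ᵛ v) ≡ c *ᵛ f v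
additive-*ᵛ {f = f} f-+ true  v = trans (cong f (true-*ᵛ v)) (sym (true-*ᵛ (f v)))
additive-*ᵛ {f = f} f-+ false v =
  trans (cong f (false-*ᵛ v)) (trans (additive-0 f-+) (sym (false-*ᵛ (f v))))

additive-combination : {f : 𝕍 m → 𝕍 n} → Additive f → ∀ cs (vs : Vec (𝕍 m) d) →
                       f (combination cs vs) ≡ combination cs (map f vs)
additive-combination         f-+ []       []       = additive-0 f-+
additive-combination {f = f} f-+ (c ∷ cs) (v ∷ vs) =
  trans (f-+ (c *ᵛ v) (combination cs vs))
        (cong₂ _+ᵛ_ (additive-*ᵛ f-+ c v) (additive-combination f-+ cs vs))

combination-+ : (vs : Vec (𝕍 n) d) → Additive (λ cs → combination cs vs)
combination-+ []       []       []       = sym (+ᵛ-self 0ᵛ)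
combination-+ (v ∷ vs) (b ∷ bs) (c ∷ cs) =
  trans (cong₂ _+ᵛ_ (*ᵛ-distribʳ b c v) (combination-+ vs bs cs))
        (+ᵛ-interchange (b *ᵛ v) (c *ᵛ v) (combination bs vs) (combination cs vs))

combination-∈ : {U : Pred (𝕍 n) 0ℓ} → IsSubspace U → ∀ cs {vs : Vec (𝕍 n) d} →
                All U vs → combination cs vs ∈ U
combination-∈ U-sub []       []       = IsSubspace.0-closed U-sub
combination-∈ U-sub (c ∷ cs) (p ∷ ps) =
  IsSubspace.+-closed U-sub (IsSubspace.*-closed U-sub c p) (combination-∈ U-sub cs ps)

standardBasis : ∀ n → Vec (𝕍 n) n
standardBasis zero    = []
standardBasis (suc n) = (true ∷ 0ᵛ) ∷ map (false ∷_) (standardBasis n)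

combination-standardBasis : (cs : 𝕍 n) → combination cs (standardBasis n) ≡ cs
combination-standardBasis             []       = refl
combination-standardBasis {n = suc n} (c ∷ cs) = begin
  c *ᵛ (true ∷ 0ᵛ) +ᵛ combination cs (map (false ∷_) (standardBasis n))
    ≡⟨ cong₂ _+ᵛ_ (cong₂ _∷_ (∧-identityʳ c) (additive-0 (*ᵛ-distribˡ c)))
                  (sym (additive-combination (λ _ _ → refl) cs (standardBasis n))) ⟩
  (c ∷ 0ᵛ) +ᵛ (false ∷ combination cs (standardBasis n))
    ≡⟨ cong₂ _∷_ (xor-identityʳ c)
                 (trans (+ᵛ-identityˡ _) (combination-standardBasis cs)) ⟩
  c ∷ cs ∎
  where open ≡-Reasoning

-- Counting vectors, and kernels of additive maps

vector↔Fin : 𝕍 n ↔ Fin (2 ℕ.^ n)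
vector↔Fin {n = zero}  =
  mk↔ₛ′ (λ _ → zero) (λ _ → []) (λ { zero → refl }) (λ { [] → refl })
vector↔Fin {n = suc n} = inverse
  (mk↔ₛ′ (λ { (b ∷ v) → b , v }) (λ (b , v) → b ∷ v) (λ _ → refl) (λ { (_ ∷ _) → refl }))
  (inverse (sym-inverse 2↔Bool ×-↔ vector↔Fin) (sym-inverse *↔×))

decode : Fin (2 ℕ.^ n) → 𝕍 n
decode = Inverse.from vector↔Fin

decode-injective : ∀ {i j} → decode {n} i ≡ decode j → i ≡ j
decode-injective {n} = Injection.injective (↔⇒↣ (sym-inverse (vector↔Fin {n})))

-- Pigeonhole in place of elimination: 2ⁿ⁺¹ vectors have only 2ⁿ possible images, so two distinct
-- vectors collide, and in characteristic 2 their sum is a nonzero vector of the kernel.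
additive-kernel : {f : 𝕍 (suc n) → 𝕍 n} → Additive f → ∃ λ v → v ≢ 0ᵛ × f v ≡ 0ᵛ
additive-kernel {n = n} {f = f} f-+
  with i , j , i<j , fi≡fj ← pigeonhole (^-monoʳ-< 2 (s<s z<s) (n<1+n n))
                                        (Inverse.to vector↔Fin ∘ f ∘ decode)
  = decode i +ᵛ decode j
  , (λ eq → Fin.<⇒≢ i<j (decode-injective (+ᵛ≡0⇒≡ _ _ eq)))
  , trans (f-+ _ _) (trans (cong (_+ᵛ f (decode j)) (Injection.injective (↔⇒↣ vector↔Fin) fi≡fj)) (+ᵛ-self _))

-- The dot product and orthogonal spaces

infix 7 _∙_

_∙_ : 𝕍 n → 𝕍 n → GF2
[]      ∙ []      = false
(a ∷ u) ∙ (b ∷ v) = (a ∧ b) xor (u ∙ v)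

∙-comm : (u v : 𝕍 n) → u ∙ v ≡ v ∙ u
∙-comm []      []      = refl
∙-comm (a ∷ u) (b ∷ v) = cong₂ _xor_ (∧-comm a b) (∙-comm u v)

∙-+ʳ : (w u v : 𝕍 n) → w ∙ (u +ᵛ v) ≡ w ∙ u xor w ∙ v
∙-+ʳ []      []      []      = refl
∙-+ʳ (c ∷ w) (a ∷ u) (b ∷ v) =
  trans (cong₂ _xor_ (∧-distribˡ-xor c a b) (∙-+ʳ w u v))
        (xor-interchange (c ∧ a) (c ∧ b) (w ∙ u) (w ∙ v))

∙-+ˡ : (u v w : 𝕍 n) → (u +ᵛ v) ∙ w ≡ u ∙ w xor v ∙ w
∙-+ˡ u v w = trans (∙-comm (u +ᵛ v) w)
  (trans (∙-+ʳ w u v) (cong₂ _xor_ (∙-comm w u) (∙-comm w v)))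

∙-zeroˡ : (v : 𝕍 n) → 0ᵛ ∙ v ≡ false
∙-zeroˡ []      = refl
∙-zeroˡ (_ ∷ v) = ∙-zeroˡ v

∙-zeroʳ : (v : 𝕍 n) → v ∙ 0ᵛ ≡ false
∙-zeroʳ v = trans (∙-comm v 0ᵛ) (∙-zeroˡ v)

-- The test vector `true ∷ 0ᵛ` reads off the first coordinate; the test vectors `false ∷ u` reduce
-- the rest to the induction hypothesis.
∙-nondegenerate : (v w : 𝕍 n) → (∀ u → v ∙ u ≡ w ∙ u) → v ≡ w
∙-nondegenerate []      []      eq = refl
∙-nondegenerate (a ∷ v) (b ∷ w) eq = cong₂ _∷_
  (trans (sym (first a v)) (trans (eq (true ∷ 0ᵛ)) (first b w)))
  (∙-nondegenerate v w λ u → trans (sym (rest a v u)) (trans (eq (false ∷ u)) (rest b w u)))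
  where
  first : ∀ {n} a (v : 𝕍 n) → (a ∷ v) ∙ (true ∷ 0ᵛ) ≡ a
  first a v = trans (cong₂ _xor_ (∧-identityʳ a) (∙-zeroʳ v)) (xor-identityʳ a)
  rest : ∀ {n} a (v u : 𝕍 n) → (a ∷ v) ∙ (false ∷ u) ≡ v ∙ u
  rest a v u = cong (_xor v ∙ u) (∧-zeroʳ a)

Orthogonal : 𝕍 n → Pred (𝕍 n) 0ℓ
Orthogonal w u = w ∙ u ≡ false

orthogonal-isSubspace : (w : 𝕍 n) → IsSubspace (Orthogonal w)
orthogonal-isSubspace w = record
  { 0-closed = ∙-zeroʳ w
  ; +-closed = λ {u} {v} p q → trans (∙-+ʳ w u v) (cong₂ _xor_ p q)
  ; *-closed = λ { true  {v} p → trans (cong (w ∙_) (true-*ᵛ v)) p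
                 ; false {v} p → trans (cong (w ∙_) (false-*ᵛ v)) (∙-zeroʳ w) }
  }

-- A linear isomorphism of `𝕍 n` with `Orthogonal w`. It serves twice: `embed` carries the standard
-- basis to a basis of the orthogonal space, and `coords` bounds the dimension of that space from
-- above.
record OrthogonalCoordinates (w : 𝕍 (suc n)) : Set where
  field
    embed        : 𝕍 n → 𝕍 (suc n)
    coords       : 𝕍 (suc n) → 𝕍 n
    embed-+      : Additive embed
    coords-+     : Additive coords
    coords-embed : ∀ y → coords (embed y) ≡ y
    embed-⊥      : ∀ y → embed y ∈ Orthogonal w
    embed-coords : ∀ {u} → u ∈ Orthogonal w → embed (coords u) ≡ u

-- At the first nonzero coordinate of `w`, orthogonality expresses that coordinate of a vector
-- through the later ones. So `coords` deletes it and `embed` recomputes it; coordinates before it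
-- are copied.
orthogonalCoordinates : (w : 𝕍 (suc n)) → w ≢ 0ᵛ → OrthogonalCoordinates w
orthogonalCoordinates (true ∷ w) _ = record
  { embed        = λ y → w ∙ y ∷ y
  ; coords       = tail
  ; embed-+      = λ u v → cong (_∷ u +ᵛ v) (∙-+ʳ w u v)
  ; coords-+     = λ { (_ ∷ _) (_ ∷ _) → refl }
  ; coords-embed = λ _ → refl
  ; embed-⊥      = λ y → xor-same (w ∙ y)
  ; embed-coords = λ { {a ∷ u} p → cong (_∷ u) (sym (xor≡false⇒≡ a (w ∙ u) p)) }
  }
orthogonalCoordinates (false ∷ [])          w≢0 = contradiction refl w≢0
orthogonalCoordinates (false ∷ w@(_ ∷ _)) w≢0 = record
  { embed        = λ { (a ∷ y) → a ∷ embed y }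
  ; coords       = λ { (a ∷ u) → a ∷ coords u }
  ; embed-+      = λ { (a ∷ u) (b ∷ v) → cong ((a xor b) ∷_) (embed-+ u v) }
  ; coords-+     = λ { (a ∷ u) (b ∷ v) → cong ((a xor b) ∷_) (coords-+ u v) }
  ; coords-embed = λ { (a ∷ y) → cong (a ∷_) (coords-embed y) }
  ; embed-⊥      = λ { (a ∷ y) → embed-⊥ y }
  ; embed-coords = λ { {a ∷ u} p → cong (a ∷_) (embed-coords p) }
  }
  where open OrthogonalCoordinates (orthogonalCoordinates w (w≢0 ∘ cong (false ∷_)))

-- Points and hyperplanes as nonzero vectors

NonZeroVectors : ℕ → Setoid _ _
NonZeroVectors n = On.setoid {B = ∃ λ (v : 𝕍 n) → v ≢ 0ᵛ} (setoid (𝕍 n)) proj₁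

line : (v : 𝕍 n) → v ≢ 0ᵛ → Subspace n 1
line v v≢0 = record
  { ⟦_⟧        = λ u → ∃ λ c → c *ᵛ v ≡ u
  ; isSubspace = record
    { 0-closed = false , false-*ᵛ v
    ; +-closed = λ { (b , refl) (c , refl) → b xor c , *ᵛ-distribʳ b c v }
    ; *-closed = λ { true  {u} (c , eq) → c , trans eq (sym (true-*ᵛ u))
                   ; false {u} _        → false , trans (false-*ᵛ v) (sym (false-*ᵛ u)) }
    }
  ; dimension  = v ∷ [] , record
    { contained   = (true , true-*ᵛ v) ∷ []
    ; independent = λ { (false ∷ []) _  → refl
                      ; (true  ∷ []) eq →
                          contradiction (trans (sym (true-*ᵛ v)) (trans (sym (+ᵛ-identityʳ _)) eq)) v≢0 }
    ; spanning    = λ (c , eq) → c ∷ [] , trans (+ᵛ-identityʳ _) eq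
    }
  }

generator : Subspace n 1 → 𝕍 n
generator P = head (proj₁ (Subspace.dimension P))

module _ (P : Subspace n 1) where

  generator-∈ : generator P ∈ ⟦ P ⟧
  generator-∈ with _ ∷ [] , basis ← Subspace.dimension P = All.head (IsBasis.contained basis)

  generator≢0 : generator P ≢ 0ᵛ
  generator≢0 v≡0 with v ∷ [] , basis ← Subspace.dimension P
    with () ← IsBasis.independent basis (true ∷ [])
                (trans (+ᵛ-identityʳ _) (trans (true-*ᵛ v) v≡0))

  -- The only scalars are 0 and 1, so a line contains a single nonzero vector. Hence `generator`
  -- depends on the point as a set and not on the chosen basis.
  ∈⇒≡generator : ∀ {u} → u ∈ ⟦ P ⟧ → u ≢ 0ᵛ → u ≡ generator P
  ∈⇒≡generator u∈P u≢0 with v ∷ [] , basis ← Subspace.dimension P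
    with IsBasis.spanning basis u∈P
  ... | true  ∷ [] , eq = trans (sym eq) (trans (+ᵛ-identityʳ _) (true-*ᵛ v))
  ... | false ∷ [] , eq =
    contradiction (trans (sym eq) (trans (+ᵛ-identityʳ _) (false-*ᵛ v))) u≢0

  generator-*-∈ : ∀ c → c *ᵛ generator P ∈ ⟦ P ⟧
  generator-*-∈ c = IsSubspace.*-closed (Subspace.isSubspace P) c generator-∈

  ∈⇒generator-* : ∀ {u} → u ∈ ⟦ P ⟧ → ∃ λ c → c *ᵛ generator P ≡ u
  ∈⇒generator-* u∈P with v ∷ [] , basis ← Subspace.dimension P
    with c ∷ [] , eq ← IsBasis.spanning basis u∈P = c , trans (sym (+ᵛ-identityʳ _)) eq

pointVectors : Inverse (SubspaceSetoid n 1) (NonZeroVectors n)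
pointVectors = record
  { to        = λ P → generator P , generator≢0 P
  ; from      = uncurry line
  ; to-cong   = λ {P} {Q} (P⊆Q , _) → generator-cong P Q P⊆Q
  ; from-cong = λ { {v , _} {w , _} refl → id , id }
  ; inverse   = (λ { {v , v≢0} {P} (_ , line⊆P) →
                     sym (∈⇒≡generator P (line⊆P (true , true-*ᵛ v)) v≢0) })
              , (λ { {P} {v , _} refl →
                     (λ { (c , refl) → generator-*-∈ P c }) , ∈⇒generator-* P })
  }
  where
  generator-cong : ∀ {n} (P Q : Subspace n 1) → ⟦ P ⟧ ⊆ ⟦ Q ⟧ → generator P ≡ generator Q
  generator-cong P Q P⊆Q = ∈⇒≡generator Q (P⊆Q (generator-∈ P)) (generator≢0 P)

orthogonal : (w : 𝕍 (suc n)) → w ≢ 0ᵛ → Subspace (suc n) n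
orthogonal {n = n} w w≢0 = record
  { ⟦_⟧        = Orthogonal w
  ; isSubspace = orthogonal-isSubspace w
  ; dimension  = map embed (standardBasis n) , record
    { contained   = All.map⁺ (All.universal embed-⊥ _)
    ; independent = λ cs eq → begin
        cs                 ≡⟨ coords-embed cs ⟨
        coords (embed cs)  ≡⟨ cong coords (trans (sym (combination-embed cs)) eq) ⟩
        coords 0ᵛ          ≡⟨ additive-0 coords-+ ⟩
        0ᵛ                 ∎
    ; spanning    = λ {u} u⊥w → coords u , trans (combination-embed (coords u)) (embed-coords u⊥w)
    }
  }
  where
  open OrthogonalCoordinates (orthogonalCoordinates w w≢0)
  open ≡-Reasoning
  combination-embed : ∀ cs → combination cs (map embed (standardBasis n)) ≡ embed cs
  combination-embed cs = trans (sym (additive-combination embed-+ cs (standardBasis n)))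
                               (cong embed (combination-standardBasis cs))

products-+ : (vs : Vec (𝕍 n) d) → Additive (λ w → map (w ∙_) vs)
products-+ []       t u = refl
products-+ (v ∷ vs) t u = cong₂ _∷_ (∙-+ˡ t u v) (products-+ vs t u)

products≡0⇒orthogonal : ∀ w (vs : Vec (𝕍 n) d) → map (w ∙_) vs ≡ 0ᵛ → All (Orthogonal w) vs
products≡0⇒orthogonal w []       eq = []
products≡0⇒orthogonal w (v ∷ vs) eq =
  ∷-injectiveˡ eq ∷ products≡0⇒orthogonal w vs (∷-injectiveʳ eq)

-- These are n homogeneous linear equations in n + 1 unknowns, so `additive-kernel` provides a
-- nonzero solution.
annihilator : (vs : Vec (𝕍 (suc n)) n) → ∃ λ w → w ≢ 0ᵛ × All (Orthogonal w) vs
annihilator vs with w , w≢0 , eq ← additive-kernel (products-+ vs)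
  = w , w≢0 , products≡0⇒orthogonal w vs eq

module _ (H : Subspace (suc n) n) where
  private
    vs : Vec (𝕍 (suc n)) n
    vs = proj₁ (Subspace.dimension H)
    open IsBasis (proj₂ (Subspace.dimension H))

  abstract
    -- Although found from a basis, this vector is determined by the set `⟦ H ⟧`: that set turns out
    -- to be its orthogonal space, and `orthogonal-injective` applies.
    normal : 𝕍 (suc n)
    normal = proj₁ (annihilator vs)

    normal≢0 : normal ≢ 0ᵛ
    normal≢0 = proj₁ (proj₂ (annihilator vs))

    vs⊥normal : All (Orthogonal normal) vs
    vs⊥normal = proj₂ (proj₂ (annihilator vs))

  ∈⇒⊥normal : ⟦ H ⟧ ⊆ Orthogonal normal
  ∈⇒⊥normal u∈H with cs , refl ← spanning u∈H =
    combination-∈ (orthogonal-isSubspace normal) cs vs⊥normal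

  open OrthogonalCoordinates (orthogonalCoordinates normal normal≢0)

  -- The n + 1 vectors u, vs lie in the n-dimensional space Orthogonal normal,
  -- so they are dependent, and u occurs in the dependence.
  ⊥normal⇒∈ : Orthogonal normal ⊆ ⟦ H ⟧
  ⊥normal⇒∈ {u} u⊥w
    with additive-kernel {f = λ cs → coords (combination cs (u ∷ vs))}
           (λ bs cs → trans (cong coords (combination-+ (u ∷ vs) bs cs)) (coords-+ _ _))
  ... | c ∷ cs , ccs≢0 , eq = solve c ccs≢0 dependent
    where
    open ≡-Reasoning

    dependent : c *ᵛ u +ᵛ combination cs vs ≡ 0ᵛ
    dependent = begin
      combination (c ∷ cs) (u ∷ vs)
        ≡⟨ embed-coords (combination-∈ (orthogonal-isSubspace normal) (c ∷ cs) (u⊥w ∷ vs⊥normal)) ⟨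
      embed (coords (combination (c ∷ cs) (u ∷ vs)))  ≡⟨ cong embed eq ⟩
      embed 0ᵛ                                        ≡⟨ additive-0 embed-+ ⟩
      0ᵛ                                              ∎

    solve : ∀ c → c ∷ cs ≢ 0ᵛ → c *ᵛ u +ᵛ combination cs vs ≡ 0ᵛ → u ∈ ⟦ H ⟧
    solve true  _     eq = subst ⟦ H ⟧
      (trans (sym (+ᵛ≡0⇒≡ _ _ eq)) (true-*ᵛ u))
      (combination-∈ (Subspace.isSubspace H) cs contained)
    solve false ccs≢0 eq = contradiction
      (cong (false ∷_) (independent cs
        (trans (sym (+ᵛ≡0⇒≡ _ _ eq)) (false-*ᵛ u))))
      ccs≢0

-- Over GF(2) a product is known once it is known whether it vanishes, so equal orthogonal spaces
-- give equal products with every vector.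
orthogonal-injective : (v w : 𝕍 n) →
                       Orthogonal v ⊆ Orthogonal w → Orthogonal w ⊆ Orthogonal v → v ≡ w
orthogonal-injective v w v⊆w w⊆v = ∙-nondegenerate v w λ u → ⇔→≡ (mk⇔ (v⊆w {u}) (w⊆v {u}))

hyperplaneVectors : Inverse (SubspaceSetoid (suc n) n) (NonZeroVectors (suc n))
hyperplaneVectors = record
  { to        = λ H → normal H , normal≢0 H
  ; from      = uncurry orthogonal
  ; to-cong   = λ {H} {K} (H⊆K , K⊆H) → orthogonal-injective (normal H) (normal K)
                  (∈⇒⊥normal K ∘ H⊆K ∘ ⊥normal⇒∈ H) (∈⇒⊥normal H ∘ K⊆H ∘ ⊥normal⇒∈ K)
  ; from-cong = λ { {v , _} {w , _} refl → id , id }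
  ; inverse   = (λ { {w , _} {H} (H⊆w , w⊆H) → orthogonal-injective (normal H) w
                       (H⊆w ∘ ⊥normal⇒∈ H) (∈⇒⊥normal H ∘ w⊆H) })
              , (λ { {H} refl → ⊥normal⇒∈ H , ∈⇒⊥normal H })
  }

-- The Singer cycle

-- next is the symmetric matrix M with ones beside the diagonal and in the last
-- corner; it generates a Singer cycle, of order 63.
next prev : 𝕍 6 → 𝕍 6
next (x₁ ∷ x₂ ∷ x₃ ∷ x₄ ∷ x₅ ∷ x₆ ∷ []) =
  x₂ ∷ (x₁ xor x₃) ∷ (x₂ xor x₄) ∷ (x₃ xor x₅) ∷ (x₄ xor x₆) ∷ (x₅ xor x₆) ∷ []
prev (y₁ ∷ y₂ ∷ y₃ ∷ y₄ ∷ y₅ ∷ y₆ ∷ []) =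
  (y₂ xor x₃) ∷ y₁ ∷ x₃ ∷ x₄ ∷ x₅ ∷ x₆ ∷ []
  where
  -- Back substitution in `next x ≡ y`: the even coordinates follow upwards from x₂ = y₁, the corner
  -- entry passes from x₆ to x₅, and the odd coordinates follow downwards to x₁.
  x₄ = y₁ xor y₃
  x₆ = x₄ xor y₅
  x₅ = x₆ xor y₆
  x₃ = y₄ xor x₅

abstract
  next-prev : ∀ v → next (prev v) ≡ v
  next-prev = from-yes (all𝕍? λ v → next (prev v) ≟ v)

  prev-next : ∀ v → prev (next v) ≡ v
  prev-next = from-yes (all𝕍? λ v → prev (next v) ≟ v)

  next-selfAdjoint : ∀ v w → next v ∙ w ≡ v ∙ next w
  next-selfAdjoint =
    from-yes (all𝕍? λ v → all𝕍? λ w → next v ∙ w Bool.≟ v ∙ next w)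

e₁ : 𝕍 6
e₁ = true ∷ 0ᵛ

abstract
  -- The discrete logarithm: Mⁿ e₁ has exponent n, and 0ᵛ has the junk value 62.
  exponent : 𝕍 6 → Fin 63
  exponent = search 62
    where
    search : ∀ m → 𝕍 6 → Fin (suc m)
    search zero    v = zero
    search (suc m) v = if does (v ≟ e₁) then zero else suc (search m (prev v))

  exponent-power : ∀ n → exponent (fold e₁ next (toℕ n)) ≡ n
  exponent-power = from-yes (Fin.all? λ n → exponent (fold e₁ next (toℕ n)) Fin.≟ n)

  -- Together with `exponent-power` this verifies the Singer property: n ↦ Mⁿ e₁ is a bijection from
  -- `Fin 63` onto the nonzero vectors.
  power-exponent : ∀ v → v ≢ 0ᵛ → fold e₁ next (toℕ (exponent v)) ≡ v
  power-exponent = from-yes (all𝕍? λ v →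
    ¬? (v ≟ 0ᵛ) →-dec fold e₁ next (toℕ (exponent v)) ≟ v)

  orbit-≢0 : ∀ (n : Fin 63) → fold e₁ next (toℕ n) ≢ 0ᵛ
  orbit-≢0 = from-yes (Fin.all? λ (n : Fin 63) → ¬? (fold e₁ next (toℕ n) ≟ 0ᵛ))

-- Units and slots: exponents modulo 21

Label : Set
Label = Fin 21 × Fin 3

-- The label `(i , c)` stands for the exponent 21c + i: the residue `i` is the unit and `c` is the
-- slot among its three vertices.
exponentOf : Label → ℕ
exponentOf (i , c) = toℕ (combine c i)

power : Label → 𝕍 6
power x = fold e₁ next (exponentOf x)

power-≢0 : ∀ x → power x ≢ 0ᵛ
power-≢0 (i , c) = orbit-≢0 (combine c i)

labels : Inverse (NonZeroVectors 6) (setoid Label)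
labels = inverse
  (record
    { to        = λ (v , _) → exponent v
    ; from      = λ n → fold e₁ next (toℕ n) , orbit-≢0 n
    ; to-cong   = cong exponent
    ; from-cong = cong (fold e₁ next ∘ toℕ)
    ; inverse   = (λ { {n} refl → exponent-power n })
                , (λ { {v , v≢0} refl → power-exponent v v≢0 })
    })
  (inverse (*↔× {3} {21}) (×-comm (Fin 3) (Fin 21)))

-- The first component of the label, but defined on bare vectors. Its value at `0ᵛ` comes from the
-- junk exponent and has no meaning.
unit : 𝕍 6 → Fin 21
unit v = proj₂ (remQuot {3} 21 (exponent v))

unit-power : ∀ i c → unit (power (i , c)) ≡ i
unit-power i c = cong proj₁ (Inverse.strictlyInverseˡ labels (i , c))

-- Subtraction modulo 21; the truncated `∸` is exact because `toℕ j` is below 21.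
_⊖_ : Fin 21 → Fin 21 → Fin 21
i ⊖ j = (toℕ i ℕ.+ (21 ℕ.∸ toℕ j)) mod 21

pred₂₁ : Fin 21 → Fin 21
pred₂₁ = _⊖ suc zero

-- ⊖ undoes the iteration of pred₂₁ whatever the slot c, because 21 steps of
-- pred₂₁ cancel: so the shift j modulo 21 is read off from the units i and i − j.
abstract
  -- M⁻¹ lowers the exponent by one modulo 63, with e₁ wrapping round from 0 to 62. Since 21 divides
  -- 63, the residue modulo 21 drops by one in that case too.
  unit-prev : ∀ v → v ≢ 0ᵛ → unit (prev v) ≡ pred₂₁ (unit v)
  unit-prev = from-yes (all𝕍? λ v → ¬? (v ≟ 0ᵛ) →-dec unit (prev v) Fin.≟ pred₂₁ (unit v))

  ⊖-pred₂₁ : ∀ i j c → i ⊖ iterate pred₂₁ i (exponentOf (j , c)) ≡ j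
  ⊖-pred₂₁ = from-yes (Fin.all? λ i → Fin.all? λ j → Fin.all? λ c →
    i ⊖ iterate pred₂₁ i (exponentOf (j , c)) Fin.≟ j)

-- A new factor of `fold` acts last, one of `iterate` first. Here the extra pair therefore encloses
-- the inductive cancellation, and in `prev^-next^` it meets in the middle, so powers need not be
-- commuted.
next^-prev^ : ∀ n v → fold (iterate prev v n) next n ≡ v
next^-prev^ zero    v = refl
next^-prev^ (suc n) v = trans (cong next (next^-prev^ n (prev v))) (next-prev v)

prev^-next^ : ∀ n v → iterate prev (fold v next n) n ≡ v
prev^-next^ zero    v = refl
prev^-next^ (suc n) v =
  trans (cong (λ u → iterate prev u n) (prev-next (fold v next n))) (prev^-next^ n v)

next^-selfAdjoint : ∀ n v w → fold v next n ∙ w ≡ v ∙ fold w next n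
next^-selfAdjoint zero    v w = refl
next^-selfAdjoint (suc n) v w = trans (next-selfAdjoint (fold v next n) w)
  -- The induction hypothesis leaves the transferred factor innermost, whereas `fold` wants it
  -- outermost.
  (trans (next^-selfAdjoint n v (next w)) (cong (v ∙_) (fold-next n)))
  where
  fold-next : ∀ n → fold (next w) next n ≡ next (fold w next n)
  fold-next zero    = refl
  fold-next (suc n) = cong next (fold-next n)

next^-0 : ∀ n → fold 0ᵛ next n ≡ 0ᵛ
next^-0 zero    = refl
next^-0 (suc n) = cong next (next^-0 n)

prev^-≢0 : ∀ n {v} → v ≢ 0ᵛ → iterate prev v n ≢ 0ᵛ
prev^-≢0 n {v} v≢0 eq = v≢0 (begin
  v                               ≡⟨ next^-prev^ n v ⟨
  fold (iterate prev v n) next n  ≡⟨ cong (λ u → fold u next n) eq ⟩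
  fold 0ᵛ next n                  ≡⟨ next^-0 n ⟩
  0ᵛ                              ∎)
  where open ≡-Reasoning

next^-≢0 : ∀ n {v} → v ≢ 0ᵛ → fold v next n ≢ 0ᵛ
next^-≢0 n {v} v≢0 eq = v≢0 (begin
  v                                ≡⟨ prev^-next^ n v ⟨
  iterate prev (fold v next n) n   ≡⟨ cong (λ u → iterate prev u n) (trans eq (sym (next^-0 n))) ⟩
  iterate prev (fold 0ᵛ next n) n  ≡⟨ prev^-next^ n 0ᵛ ⟩
  0ᵛ                               ∎)
  where open ≡-Reasoning

unit-prev^ : ∀ n {v} → v ≢ 0ᵛ → unit (iterate prev v n) ≡ iterate pred₂₁ (unit v) n
unit-prev^ zero        v≢0 = refl
unit-prev^ (suc n) {v} v≢0 =
  trans (unit-prev^ n (prev^-≢0 1 v≢0)) (cong (λ i → iterate pred₂₁ i n) (unit-prev v v≢0))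

-- Vectors orthogonal to a power of the Singer cycle

e₁-∙ : ∀ v → e₁ ∙ v ≡ head v
e₁-∙ (a ∷ v) = trans (cong (a xor_) (∙-zeroˡ v)) (xor-identityʳ a)

-- Since decode zero is 0ᵛ, the shift by suc leaves out the zero vector.
e₁⊥ : Fin 31 → 𝕍 6
e₁⊥ k = false ∷ decode {5} (suc k)

e₁⊥-≢0 : ∀ k → e₁⊥ k ≢ 0ᵛ
e₁⊥-≢0 k eq with () ← decode-injective {5} {suc k} {zero} (∷-injectiveʳ eq)

e₁⊥-injective : ∀ {k l} → e₁⊥ k ≡ e₁⊥ l → k ≡ l
e₁⊥-injective eq = Fin.suc-injective (decode-injective {5} (∷-injectiveʳ eq))

e₁⊥-surjective : ∀ v → v ≢ 0ᵛ → head v ≡ false → ∃ λ k → e₁⊥ k ≡ v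
e₁⊥-surjective (false ∷ v) v≢0 _
  with Inverse.to (vector↔Fin {5}) v | Inverse.strictlyInverseʳ (vector↔Fin {5}) v
... | zero  | refl = contradiction refl v≢0
... | suc k | eq   = k , cong (false ∷_) eq

-- power x is Mⁿ e₁ with M symmetric and n = exponentOf x, so M⁻ⁿ maps the
-- vectors orthogonal to e₁ onto those orthogonal to power x.
perp : Label → Fin 31 → 𝕍 6
perp x k = iterate prev (e₁⊥ k) (exponentOf x)

perp-≢0 : ∀ x k → perp x k ≢ 0ᵛ
perp-≢0 x k = prev^-≢0 (exponentOf x) (e₁⊥-≢0 k)

-- Moving Mⁿ across the product reduces orthogonality to any `power x` to orthogonality to e₁, which
-- is a vanishing first coordinate.
power-∙ : ∀ x v → power x ∙ v ≡ head (fold v next (exponentOf x))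
power-∙ x v = trans (next^-selfAdjoint (exponentOf x) e₁ v) (e₁-∙ (fold v next (exponentOf x)))

power-∙-perp : ∀ x k → power x ∙ perp x k ≡ false
power-∙-perp x k =
  trans (power-∙ x (perp x k)) (cong head (next^-prev^ (exponentOf x) (e₁⊥ k)))

perp-injective : ∀ x {k l} → perp x k ≡ perp x l → k ≡ l
perp-injective x {k} {l} eq = e₁⊥-injective (begin
  e₁⊥ k                                 ≡⟨ next^-prev^ (exponentOf x) (e₁⊥ k) ⟨
  fold (perp x k) next (exponentOf x)   ≡⟨ cong (λ v → fold v next (exponentOf x)) eq ⟩
  fold (perp x l) next (exponentOf x)   ≡⟨ next^-prev^ (exponentOf x) (e₁⊥ l) ⟩
  e₁⊥ l                                 ∎)
  where open ≡-Reasoning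

perp-surjective : ∀ x v → v ≢ 0ᵛ → power x ∙ v ≡ false → ∃ λ k → perp x k ≡ v
perp-surjective x v v≢0 power⊥v
  with k , eq ← e₁⊥-surjective (fold v next (exponentOf x)) (next^-≢0 (exponentOf x) v≢0)
                  (trans (sym (power-∙ x v)) power⊥v)
  = k , trans (cong (λ u → iterate prev u (exponentOf x)) eq) (prev^-next^ (exponentOf x) v)

-- This excludes conflicts in phase 2. With `c` and `k` fixed, all units start from the same
-- `e₁⊥ k`, of residue `u`; unit `i` reaches residue u - i modulo 21, and subtracting this from `u`
-- gives back `i`.
unit-perp-injective : ∀ c k → Injective _≡_ _≡_ (λ i → unit (perp (i , c) k))
unit-perp-injective c k {i} {j} eq = begin
  i                                          ≡⟨ ⊖-pred₂₁ u i c ⟨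
  u ⊖ iterate pred₂₁ u (exponentOf (i , c))  ≡⟨ cong (u ⊖_) (unit-perp i) ⟨
  u ⊖ unit (perp (i , c) k)                  ≡⟨ cong (u ⊖_) eq ⟩
  u ⊖ unit (perp (j , c) k)                  ≡⟨ cong (u ⊖_) (unit-perp j) ⟩
  u ⊖ iterate pred₂₁ u (exponentOf (j , c))  ≡⟨ ⊖-pred₂₁ u j c ⟩
  j                                          ∎
  where
  open ≡-Reasoning
  u : Fin 21
  u = unit (e₁⊥ k)
  unit-perp : ∀ i → unit (perp (i , c) k) ≡ iterate pred₂₁ u (exponentOf (i , c))
  unit-perp i = unit-prev^ (exponentOf (i , c)) (e₁⊥-≢0 k)

-- Schedules from labellings

module _ {S : Setoid a ℓ} {N m : ℕ} (label : Inverse S (setoid (Fin N × Fin m))) where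
  open Inverse label using (from; to-cong; from-cong; inverseʳ; strictlyInverseˡ)
    renaming (to to toLabel)

  partition : EqualPartition S N
  partition = record
    { block     = record { to = proj₁ ∘ toLabel ; cong = cong proj₁ ∘ to-cong }
    ; blockSize = m
    ; equalSize = λ i → record
      { to        = λ c → from (i , c) , cong proj₁ (strictlyInverseˡ (i , c))
      ; cong      = from-cong ∘ cong (i ,_)
      ; bijective =
          (λ {c} {c′} eq → cong proj₂
             (trans (sym (strictlyInverseˡ (i , c))) (trans (to-cong eq) (strictlyInverseˡ (i , c′)))))
        , (λ { (s , refl) → proj₂ (toLabel s) , inverseʳ ∘ cong (_ ,_) })
      }
    }

module _ {V : Setoid a ℓ} {vertex : Func Edges V} {N m d : ℕ}
         (label : Inverse V (setoid (Fin N × Fin m)))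
         (μ : Func Edges (setoid (Fin N)))
         (star : Fin N × Fin m → Fin d → Edge)
         where
  open Setoid V using (_≈_)
  open Setoid Edges using () renaming (_≈_ to _≈ᴱ_)
  open Inverse label using (from; to-cong; from-cong; inverseˡ; inverseʳ; strictlyInverseˡ)
    renaming (to to toLabel)

  -- All units run in lockstep: at step r = qd + k each accesses edge `k` of its vertex in slot `q`.
  -- Consecutiveness then comes from monotonicity of the quotient, and conflicts need excluding only
  -- between vertices in the same slot at the same `k`.
  conflictFreeOrder :
    (∀ x k → to vertex (star x k) ≈ from x) →
    (∀ x {k l} → star x k ≈ᴱ star x l → k ≡ l) →
    (∀ x e → to vertex e ≈ from x → ∃ λ k → star x k ≈ᴱ e) →
    (∀ c k → Injective _≡_ _≡_ (λ i → to μ (star (i , c) k))) →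
    ConflictFreeOrder (m ℕ.* d) V vertex (partition label) μ
  conflictFreeOrder star-vertex star-injective star-surjective star-conflictFree = record
    { order        = λ i → record
      { to        = λ r → access i r , cong proj₁ (label-access i r)
      ; cong      = λ { {r} refl → Setoid.refl Edges {access i r} }
      ; bijective = access-injective i , λ (e , e∈i) → access-surjective i e e∈i
      }
    ; consecutive  = λ i r≤s s≤t eq → Setoid.trans V (star-vertex _ _)
        (Setoid.trans V
          (from-cong (cong (i ,_) (quotient-convex r≤s s≤t (same-slot i eq))))
          (Setoid.sym V (star-vertex _ _)))
    ; conflictFree = λ r → star-conflictFree (quotient r) (remainder r)
    }
    where
    quotient : Fin (m ℕ.* d) → Fin m
    quotient r = proj₁ (remQuot d r)

    remainder : Fin (m ℕ.* d) → Fin d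
    remainder r = proj₂ (remQuot {m} d r)

    access : Fin N → Fin (m ℕ.* d) → Edge
    access i r = star (i , quotient r) (remainder r)

    label-access : ∀ i r → toLabel (to vertex (access i r)) ≡ (i , quotient r)
    label-access i r = inverseˡ (star-vertex _ _)

    same-slot : ∀ i {r s} → to vertex (access i r) ≈ to vertex (access i s) →
                quotient r ≡ quotient s
    same-slot i {r} {s} eq = cong proj₂
      (trans (sym (label-access i r)) (trans (to-cong eq) (label-access i s)))

    access-injective : ∀ i {r s} → access i r ≈ᴱ access i s → r ≡ s
    access-injective i {r} {s} eq = begin
      r                                   ≡⟨ combine-remQuot {m} d r ⟨
      combine (quotient r) (remainder r)  ≡⟨ cong₂ combine quotient≡ (remainder≡ quotient≡ eq) ⟩
      combine (quotient s) (remainder s)  ≡⟨ combine-remQuot {m} d s ⟩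
      s                                   ∎
      where
      open ≡-Reasoning
      quotient≡ : quotient r ≡ quotient s
      quotient≡ = same-slot i (Func.cong vertex eq)
      -- Generalised over both slots, so that their equality can be matched and the two edges become
      -- edges of one star.
      remainder≡ : ∀ {b c k l} → b ≡ c → star (i , b) k ≈ᴱ star (i , c) l → k ≡ l
      remainder≡ refl = star-injective _

    access-surjective : ∀ i e → proj₁ (toLabel (to vertex e)) ≡ i →
                        ∃ λ r → ∀ {s} → s ≡ r → access i s ≈ᴱ e
    access-surjective i e refl
      with k , eq ← star-surjective (toLabel (to vertex e)) e (Setoid.sym V (inverseʳ refl))
      = combine (proj₂ (toLabel (to vertex e))) k
      , λ { refl → subst (λ (c , l) → star (i , c) l ≈ᴱ e)
                         (sym (remQuot-combine (proj₂ (toLabel (to vertex e))) k)) eq }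

    -- By contraposition: a strictly smaller quotient forces a strictly smaller step, whatever the
    -- remainders.
    quotient-mono : ∀ {r s} → r Fin.≤ s → quotient r Fin.≤ quotient s
    quotient-mono {r} {s} r≤s = ≮⇒≥ λ qs<qr → <⇒≱
      (subst₂ Fin._<_ (combine-remQuot {m} d s) (combine-remQuot {m} d r)
        (combine-monoˡ-< (remainder s) (remainder r) qs<qr))
      r≤s

    quotient-convex : ∀ {r s t} → r Fin.≤ s → s Fin.≤ t →
                      quotient r ≡ quotient t → quotient s ≡ quotient r
    quotient-convex {r} {s} {t} r≤s s≤t eq = Fin.≤-antisym
      (subst (quotient s Fin.≤_) (sym eq) (quotient-mono s≤t)) (quotient-mono r≤s)

-- The schedule for the 5-dimensional space

pointLabels : Inverse Points (setoid Label)
pointLabels = inverse pointVectors labels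

hyperplaneLabels : Inverse Hyperplanes (setoid Label)
hyperplaneLabels = inverse hyperplaneVectors labels

edge : (v w : 𝕍 6) → v ≢ 0ᵛ → w ≢ 0ᵛ → w ∙ v ≡ false → Edge
edge v w v≢0 w≢0 v⊥w = record
  { point      = line v v≢0
  ; hyperplane = orthogonal w w≢0
  ; incident   = λ { (c , refl) → IsSubspace.*-closed (orthogonal-isSubspace w) c v⊥w }
  }

edge-⊥ : (e : Edge) → normal (Edge.hyperplane e) ∙ generator (Edge.point e) ≡ false
edge-⊥ e = ∈⇒⊥normal (Edge.hyperplane e) (Edge.incident e (generator-∈ (Edge.point e)))

memory : Func Edges (setoid (Fin 21))
memory = record
  { to   = proj₁ ∘ Inverse.to pointLabels ∘ Edge.point
  ; cong = λ {e} {f} (P≈Q , _) →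
      cong proj₁ (Inverse.to-cong pointLabels {Edge.point e} {Edge.point f} P≈Q)
  }

-- Since the product is symmetric, one list `perp x` gives both the normals of the hyperplanes
-- through the point `power x` and the points on the hyperplane with normal `power x`.
pointStar hyperplaneStar : Label → Fin 31 → Edge
pointStar x k =
  edge (power x) (perp x k) (power-≢0 x) (perp-≢0 x k)
    (trans (∙-comm (perp x k) (power x)) (power-∙-perp x k))
hyperplaneStar x k =
  edge (perp x k) (power x) (perp-≢0 x k) (power-≢0 x) (power-∙-perp x k)

private
  module PointSpace      = Setoid Points
  module HyperplaneSpace = Setoid Hyperplanes
  module EdgeSpace       = Setoid Edges
  module PointVectors      = Inverse (pointVectors {6})
  module HyperplaneVectors = Inverse (hyperplaneVectors {5})

pointStar-injective : ∀ x {k l} → pointStar x k EdgeSpace.≈ pointStar x l → k ≡ l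
pointStar-injective x {k} {l} (_ , H⊆K , K⊆H) =
  perp-injective x (orthogonal-injective (perp x k) (perp x l) H⊆K K⊆H)

pointStar-surjective : ∀ x e → Edge.point e PointSpace.≈ Inverse.from pointLabels x →
                       ∃ λ k → pointStar x k EdgeSpace.≈ e
pointStar-surjective x e P≈x =
  let w = normal (Edge.hyperplane e)
      v≡ = PointVectors.inverseˡ {power x , power-≢0 x} {Edge.point e} P≈x
      k , eq = perp-surjective x w (normal≢0 (Edge.hyperplane e))
                 (trans (∙-comm (power x) w) (trans (cong (w ∙_) (sym v≡)) (edge-⊥ e)))
  in k , PointSpace.sym {Edge.point e} {Inverse.from pointLabels x} P≈x
       , HyperplaneVectors.inverseʳ {Edge.hyperplane e} {perp x k , perp-≢0 x k} eq

hyperplaneStar-injective : ∀ x {k l} → hyperplaneStar x k EdgeSpace.≈ hyperplaneStar x l →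
                           k ≡ l
hyperplaneStar-injective x {k} {l} (P≈Q , _) = perp-injective x
  (PointVectors.to-cong {line (perp x k) (perp-≢0 x k)} {line (perp x l) (perp-≢0 x l)} P≈Q)

hyperplaneStar-surjective : ∀ x e →
                            Edge.hyperplane e HyperplaneSpace.≈ Inverse.from hyperplaneLabels x →
                            ∃ λ k → hyperplaneStar x k EdgeSpace.≈ e
hyperplaneStar-surjective x e H≈x =
  let v = generator (Edge.point e)
      w≡ = HyperplaneVectors.inverseˡ {power x , power-≢0 x} {Edge.hyperplane e} H≈x
      k , eq = perp-surjective x v (generator≢0 (Edge.point e))
                 (trans (cong (_∙ v) (sym w≡)) (edge-⊥ e))
  in k , PointVectors.inverseʳ {Edge.point e} {perp x k , perp-≢0 x k} eq
       , HyperplaneSpace.sym {Edge.hyperplane e} {Inverse.from hyperplaneLabels x} H≈x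

-- The length 93 is 3 · 31, three slots of 31 edges each, and equals 31 · 63 / 21.
pointPhase : ConflictFreeOrder 93 Points pointOf (partition pointLabels) memory
pointPhase = conflictFreeOrder {vertex = pointOf} pointLabels memory pointStar
  (λ x _ → PointSpace.refl {Inverse.from pointLabels x})
  pointStar-injective
  pointStar-surjective
  -- Every edge of a point of unit `i` is stored in memory `i`, so each unit stays in its own
  -- memory.
  (λ c _ {i} {j} eq → trans (sym (unit-power i c)) (trans eq (unit-power j c)))

hyperplanePhase : ConflictFreeOrder 93 Hyperplanes hyperplaneOf (partition hyperplaneLabels) memory
hyperplanePhase = conflictFreeOrder {vertex = hyperplaneOf} hyperplaneLabels memory hyperplaneStar
  (λ x _ → HyperplaneSpace.refl {Inverse.from hyperplaneLabels x})
  hyperplaneStar-injective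
  hyperplaneStar-surjective
  unit-perp-injective

proposition2 : FoldedConflictFreeSchedule 21
proposition2 = record
  { pointUnits      = partition pointLabels
  ; hyperplaneUnits = partition hyperplaneLabels
  ; μ               = memory
  ; phase₁          = pointPhase
  ; phase₂          = hyperplanePhase
  }
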